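{- Let $\mathcal{Q}$ be a small quantaloid and let $S\dashv T:\mathbb{D}\to\mathbb{C}$ be an adjunction of $\mathcal{Q}$-functors between complete $\mathcal{Q}$-categories $\mathbb{C},\mathbb{D}$. Then a complete $\mathcal{Q}$-category $\mathbb{X}$ is equivalent to $\mathrm{Fix}(TS)$ if, and only if, there exist $\mathcal{Q}$-categories $\mathbb{A},\mathbb{B}$, dense $\mathcal{Q}$-functors $F:\mathbb{A}\to\mathbb{X}$, $K:\mathbb{A}\to\mathbb{C}$ and codense $\mathcal{Q}$-functors $G:\mathbb{B}\to\mathbb{X}$, $H:\mathbb{B}\to\mathbb{D}$ with $H^{\natural}\circ S_{\natural}\circ K_{\natural}=G^{\natural}\circ F_{\natural}$.
   Context: A quantaloid $\mathcal{Q}$ is a category whose hom-sets are complete lattices and whose composition $\circ$ preserves joins in each variable; small means it has a set $\mathcal{Q}_0$ of objects; $1_q$ denotes identities. For $u:p\to q$, $v:q\to r$, $w:p\to r$, the implications $w\swarrow u:q\to r$ and $v\searrow w:p\to q$ are determined by $v\circ u\leq w\iff v\leq w\swarrow u\iff u\leq v\searrow w$. A $\mathcal{Q}$-typed set is a set $A$ with a map $|\cdot|:A\to\mathcal{Q}_0$; maps preserving types are type-preserving. A $\mathcal{Q}$-category $\mathbb{A}$ is a $\mathcal{Q}$-typed set $\mathbb{A}_0$ with arrows $\mathbb{A}(x,y)\in\mathcal{Q}(|x|,|y|)$ such that $1_{|x|}\leq\mathbb{A}(x,x)$ and $\mathbb{A}(y,z)\circ\mathbb{A}(x,y)\leq\mathbb{A}(x,z)$.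 A $\mathcal{Q}$-subcategory is a subset of objects with the same hom-arrows. The underlying preorder: $x\leq y$ iff $|x|=|y|$ and $1_{|x|}\leq\mathbb{A}(x,y)$; $x\cong y$ means $x\leq y$ and $y\leq x$. A $\mathcal{Q}$-functor $F:\mathbb{A}\to\mathbb{B}$ is a type-preserving map $\mathbb{A}_0\to\mathbb{B}_0$ with $\mathbb{A}(x,x')\leq\mathbb{B}(Fx,Fx')$; $\mathcal{Q}$-functors are (pre)ordered pointwise, and $F\cong G$ means $F\le G$ and $G\le F$. $S\dashv T:\mathbb{D}\to\mathbb{C}$ means $\mathcal{Q}$-functors $S:\mathbb{C}\to\mathbb{D}$, $T:\mathbb{D}\to\mathbb{C}$ with $1_{\mathbb{C}}\leq TS$ and $ST\leq 1_{\mathbb{D}}$. $\mathrm{Fix}(TS)$ is the $\mathcal{Q}$-subcategory of $\mathbb{C}$ of objects $c$ with $TSc\cong c$. $\mathbb{A}$ and $\mathbb{B}$ are equivalent if there are $\mathcal{Q}$-functors $F:\mathbb{A}\to\mathbb{B}$, $G:\mathbb{B}\to\mathbb{A}$ with $GF\cong1_{\mathbb{A}}$, $FG\cong1_{\mathbb{B}}$. A $\mathcal{Q}$-distributor $\phi:\mathbb{A}\nrightarrow\mathbb{B}$ is a family of arrows $\phi(x,y):|x|\to|y|$ ($x\in\mathbb{A}_0,y\in\mathbb{B}_0$) with $\mathbb{B}(y,y')\circ\phi(x,y)\circ\mathbb{A}(x',x)\leq\phi(x',y')$. For $\phi:\mathbb{A}\nrightarrow\mathbb{B}$, $\psi:\mathbb{B}\nrightarrow\mathbb{C}$,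 $\xi:\mathbb{A}\nrightarrow\mathbb{C}$: $(\psi\circ\phi)(x,z)=\bigvee_{y}\psi(y,z)\circ\phi(x,y)$, $(\xi\swarrow\phi)(y,z)=\bigwedge_{x}\xi(x,z)\swarrow\phi(x,y)$, $(\psi\searrow\xi)(x,y)=\bigwedge_{z}\psi(y,z)\searrow\xi(x,z)$. For a $\mathcal{Q}$-functor $F:\mathbb{A}\to\mathbb{B}$: $F_\natural:\mathbb{A}\nrightarrow\mathbb{B}$, $F_\natural(x,y)=\mathbb{B}(Fx,y)$, and $F^\natural:\mathbb{B}\nrightarrow\mathbb{A}$, $F^\natural(y,x)=\mathbb{B}(y,Fx)$. $\{q\}$ is the $\mathcal{Q}$-category with one object of type $q$ and hom-arrow $1_q$. Presheaves of type $q$ on $\mathbb{A}$ are distributors $\mu:\mathbb{A}\nrightarrow\{q\}$; they form the $\mathcal{Q}$-category $\mathsf{P}\mathbb{A}$ with $\mathsf{P}\mathbb{A}(\mu,\mu')=\mu'\swarrow\mu$. Copresheaves of type $q$ are distributors $\lambda:\{q\}\nrightarrow\mathbb{A}$; they form $\mathsf{P}^{\dagger}\mathbb{A}$ with $\mathsf{P}^{\dagger}\mathbb{A}(\lambda,\lambda')=\lambda'\searrow\lambda$. For $F:\mathbb{A}\to\mathbb{B}$ and $\mu\in\mathsf{P}\mathbb{A}$, $\mathrm{colim}_\mu F$ is an object of $\mathbb{B}$ of type $|\mu|$ with $\mathbb{B}(\mathrm{colim}_\mu F,-)=F_\natural\swarrow\mu$; for $\lambda\in\mathsf{P}^\dagger\mathbb{A}$,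 $\lim_\lambda F$ is an object of type $|\lambda|$ with $\mathbb{B}(-,\lim_\lambda F)=\lambda\searrow F^\natural$. $\mathbb{B}$ is complete if it admits all weighted colimits (equivalently, all weighted limits). $F:\mathbb{A}\to\mathbb{B}$ is dense (resp. codense) if for every $y\in\mathbb{B}_0$ there is $\mu\in\mathsf{P}\mathbb{A}$ with $y\cong\mathrm{colim}_\mu F$ (resp. $\lambda\in\mathsf{P}^\dagger\mathbb{A}$ with $y\cong\lim_\lambda F$). -}

module Defs where

open import Data.Product using (Σ; Σ-syntax; _×_; _,_; proj₁; proj₂)
open import Level using (Level; suc)
open import Relation.Binary.Bundles using (Poset)

-- Size convention: "set" is read as Set ℓ for one arbitrary level ℓ, for the
-- objects and hom-sets of a quantaloid as for the objects of 𝒬-categories.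
-- Subsets X → Set ℓ of X : Set ℓ and families I → X with I : Set ℓ then have
-- the same joins, and presheaves on a 𝒬-category again form a Set ℓ.

record CompleteLattice (ℓ : Level) : Set (suc ℓ) where
  field
    poset : Poset ℓ ℓ ℓ

  open Poset poset public

  field
    ⋁       : {I : Set ℓ} → (I → Carrier) → Carrier
    ⋁-upper : {I : Set ℓ} (f : I → Carrier) (i : I) → f i ≤ ⋁ f
    ⋁-least : {I : Set ℓ} (f : I → Carrier) {w : Carrier} →
              (∀ i → f i ≤ w) → ⋁ f ≤ w

  ⋀ : {I : Set ℓ} → (I → Carrier) → Carrier
  ⋀ {I} f = ⋁ {Σ[ w ∈ Carrier ] (∀ i → w ≤ f i)} proj₁

  ⋀-lower : {I : Set ℓ} (f : I → Carrier) (i : I) → ⋀ f ≤ f i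
  ⋀-lower f i = ⋁-least proj₁ λ (_ , w≤f) → w≤f i

  ⋀-greatest : {I : Set ℓ} (f : I → Carrier) {w : Carrier} →
               (∀ i → w ≤ f i) → w ≤ ⋀ f
  ⋀-greatest f {w} w≤f = ⋁-upper proj₁ (w , w≤f)

record Quantaloid (ℓ : Level) : Set (suc ℓ) where
  infixr 9 _∘_
  infixl 8 _↙_
  infixr 8 _↘_

  field
    Obj : Set ℓ
    hom : Obj → Obj → CompleteLattice ℓ

  private module L {p q : Obj} = CompleteLattice (hom p q)
  open L public
    using ( _≤_; _≈_; ⋁; ⋁-upper; ⋁-least; ⋀; ⋀-lower; ⋀-greatest
          ; refl; reflexive; trans; antisym; module Eq)

  Hom : Obj → Obj → Set ℓ
  Hom p q = CompleteLattice.Carrier (hom p q)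

  field
    id        : ∀ {q} → Hom q q
    _∘_       : ∀ {p q r} → Hom q r → Hom p q → Hom p r
    ∘-cong    : ∀ {p q r} {v v′ : Hom q r} {u u′ : Hom p q} →
                v ≈ v′ → u ≈ u′ → v ∘ u ≈ v′ ∘ u′
    identityˡ : ∀ {p q} (u : Hom p q) → id ∘ u ≈ u
    identityʳ : ∀ {p q} (u : Hom p q) → u ∘ id ≈ u
    assoc     : ∀ {p q r s} (w : Hom r s) (v : Hom q r) (u : Hom p q) →
                (w ∘ v) ∘ u ≈ w ∘ (v ∘ u)
    ∘-⋁ʳ      : ∀ {p q r} (v : Hom q r) {I : Set ℓ} (f : I → Hom p q) →
                v ∘ ⋁ f ≈ ⋁ (λ i → v ∘ f i)
    ∘-⋁ˡ      : ∀ {p q r} {I : Set ℓ} (f : I → Hom q r) (u : Hom p q) →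
                ⋁ f ∘ u ≈ ⋁ (λ i → f i ∘ u)

  _↙_ : ∀ {p q r} → Hom p r → Hom p q → Hom q r
  _↙_ {p} {q} {r} w u = ⋁ {I = Σ[ v ∈ Hom q r ] v ∘ u ≤ w} proj₁

  _↘_ : ∀ {p q r} → Hom q r → Hom p r → Hom p q
  _↘_ {p} {q} {r} v w = ⋁ {I = Σ[ u ∈ Hom p q ] v ∘ u ≤ w} proj₁

  ∘-monoʳ : ∀ {p q r} (v : Hom q r) {u u′ : Hom p q} → u ≤ u′ → v ∘ u ≤ v ∘ u′
  ∘-monoʳ {p} {q} v {u} {u′} u≤u′ =
    trans (⋁-upper (λ i → v ∘ proj₁ i) (u , u≤u′))
      (reflexive (Eq.trans (Eq.sym (∘-⋁ʳ v below)) (∘-cong Eq.refl ⋁below≈u′)))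
    where
    below : (Σ[ w ∈ Hom p q ] w ≤ u′) → Hom p q
    below = proj₁
    ⋁below≈u′ : ⋁ below ≈ u′
    ⋁below≈u′ = antisym (⋁-least below proj₂) (⋁-upper below (u′ , refl))

  ∘-monoˡ : ∀ {p q r} {v v′ : Hom q r} (u : Hom p q) → v ≤ v′ → v ∘ u ≤ v′ ∘ u
  ∘-monoˡ {p} {q} {r} {v} {v′} u v≤v′ =
    trans (⋁-upper (λ i → proj₁ i ∘ u) (v , v≤v′))
      (reflexive (Eq.trans (Eq.sym (∘-⋁ˡ below u)) (∘-cong ⋁below≈v′ Eq.refl)))
    where
    below : (Σ[ w ∈ Hom q r ] w ≤ v′) → Hom q r
    below = proj₁
    ⋁below≈v′ : ⋁ below ≈ v′
    ⋁below≈v′ = antisym (⋁-least below proj₂) (⋁-upper below (v′ , refl))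

  ∘-mono : ∀ {p q r} {v v′ : Hom q r} {u u′ : Hom p q} →
           v ≤ v′ → u ≤ u′ → v ∘ u ≤ v′ ∘ u′
  ∘-mono {v′ = v′} {u = u} v≤v′ u≤u′ = trans (∘-monoˡ u v≤v′) (∘-monoʳ v′ u≤u′)

  ↙-intro : ∀ {p q r} {v : Hom q r} {u : Hom p q} {w : Hom p r} →
            v ∘ u ≤ w → v ≤ w ↙ u
  ↙-intro {v = v} vu≤w = ⋁-upper proj₁ (v , vu≤w)

  ↙-elim : ∀ {p q r} {v : Hom q r} {u : Hom p q} {w : Hom p r} →
            v ≤ w ↙ u → v ∘ u ≤ w
  ↙-elim {u = u} v≤w↙u = trans (∘-monoˡ u v≤w↙u)
    (trans (reflexive (∘-⋁ˡ proj₁ u)) (⋁-least (λ i → proj₁ i ∘ u) proj₂))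

  ↘-intro : ∀ {p q r} {v : Hom q r} {u : Hom p q} {w : Hom p r} →
            v ∘ u ≤ w → u ≤ v ↘ w
  ↘-intro {u = u} vu≤w = ⋁-upper proj₁ (u , vu≤w)

  ↘-elim : ∀ {p q r} {v : Hom q r} {u : Hom p q} {w : Hom p r} →
            u ≤ v ↘ w → v ∘ u ≤ w
  ↘-elim {v = v} u≤v↘w = trans (∘-monoʳ v u≤v↘w)
    (trans (reflexive (∘-⋁ʳ v proj₁)) (⋁-least (λ i → v ∘ proj₁ i) proj₂))

-- A 𝒬-typed set |·| : A → 𝒬₀ is encoded by its fibres: Ob q is the set of
-- elements of type q, the underlying set is Total, and |·| is proj₁.  A
-- type-preserving map is then a map of fibres, and elements can be compared
-- in the underlying preorder only when they have the same type.
record QCat {ℓ : Level} (Q : Quantaloid ℓ) : Set (suc ℓ) where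
  open Quantaloid Q using (Obj; Hom; _≤_; id; _∘_)
  infix 4 _⊑_ _≅_

  field
    Ob   : Obj → Set ℓ
    hom  : ∀ {p q} → Ob p → Ob q → Hom p q
    unit : ∀ {q} (x : Ob q) → id ≤ hom x x
    comp : ∀ {p q r} (x : Ob p) (y : Ob q) (z : Ob r) →
           hom y z ∘ hom x y ≤ hom x z

  Total : Set ℓ
  Total = Σ[ q ∈ Obj ] Ob q

  _⊑_ : ∀ {q} → Ob q → Ob q → Set ℓ
  x ⊑ y = id ≤ hom x y

  _≅_ : ∀ {q} → Ob q → Ob q → Set ℓ
  x ≅ y = x ⊑ y × y ⊑ x

module _ {ℓ : Level} {Q : Quantaloid ℓ} where
  open Quantaloid Q

  subcategory : (C : QCat Q) → (∀ {q} → QCat.Ob C q → Set ℓ) → QCat Q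
  subcategory C P = record
    { Ob   = λ q → Σ[ c ∈ C.Ob q ] P c
    ; hom  = λ x y → C.hom (proj₁ x) (proj₁ y)
    ; unit = λ x → C.unit (proj₁ x)
    ; comp = λ x y z → C.comp (proj₁ x) (proj₁ y) (proj₁ z)
    }
    where module C = QCat C

  record QFunctor (A B : QCat Q) : Set ℓ where
    private
      module A = QCat A
      module B = QCat B
    field
      map  : ∀ {q} → A.Ob q → B.Ob q
      mono : ∀ {p q} (x : A.Ob p) (y : A.Ob q) → A.hom x y ≤ B.hom (map x) (map y)

  open QFunctor public using (map; mono)

  idᶠ : {A : QCat Q} → QFunctor A A
  idᶠ = record { map = λ x → x ; mono = λ _ _ → refl }

  infixr 9 _∘ᶠ_
  _∘ᶠ_ : {A B C : QCat Q} → QFunctor B C → QFunctor A B → QFunctor A C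
  G ∘ᶠ F = record
    { map  = λ x → map G (map F x)
    ; mono = λ x y → trans (mono F x y) (mono G (map F x) (map F y))
    }

  infix 4 _≤ᶠ_ _≅ᶠ_
  _≤ᶠ_ _≅ᶠ_ : {A B : QCat Q} → QFunctor A B → QFunctor A B → Set ℓ
  _≤ᶠ_ {A} {B} F G = ∀ {q} (x : QCat.Ob A q) → QCat._⊑_ B (map F x) (map G x)
  F ≅ᶠ G = F ≤ᶠ G × G ≤ᶠ F

  infix 4 _⊣_
  _⊣_ : {C D : QCat Q} → QFunctor C D → QFunctor D C → Set ℓ
  S ⊣ T = idᶠ ≤ᶠ T ∘ᶠ S × S ∘ᶠ T ≤ᶠ idᶠ

  Fix : {C : QCat Q} → QFunctor C C → QCat Q
  Fix {C} E = subcategory C (λ c → QCat._≅_ C (map E c) c)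

  Equivalent : QCat Q → QCat Q → Set ℓ
  Equivalent A B =
    Σ[ F ∈ QFunctor A B ] Σ[ G ∈ QFunctor B A ] (G ∘ᶠ F ≅ᶠ idᶠ × F ∘ᶠ G ≅ᶠ idᶠ)

  infix 1 _⇸_
  record _⇸_ (A B : QCat Q) : Set ℓ where
    private
      module A = QCat A
      module B = QCat B
    field
      arr : ∀ {p q} → A.Ob p → B.Ob q → Hom p q
      act : ∀ {p p′ q q′} (x′ : A.Ob p′) (x : A.Ob p) (y : B.Ob q) (y′ : B.Ob q′) →
            B.hom y y′ ∘ arr x y ∘ A.hom x′ x ≤ arr x′ y′

  open _⇸_ public using (arr; act)

  infix 4 _≈ᴰ_
  _≈ᴰ_ : {A B : QCat Q} → A ⇸ B → A ⇸ B → Set ℓ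
  _≈ᴰ_ {A} {B} φ ψ =
    ∀ {p q} (x : QCat.Ob A p) (y : QCat.Ob B q) → arr φ x y ≈ arr ψ x y

  actˡ : {A B : QCat Q} (φ : A ⇸ B) → ∀ {p q q′}
         (x : QCat.Ob A p) (y : QCat.Ob B q) (y′ : QCat.Ob B q′) →
         QCat.hom B y y′ ∘ arr φ x y ≤ arr φ x y′
  actˡ {A} {B} φ x y y′ =
    trans (∘-monoʳ _ (trans (reflexive (Eq.sym (identityʳ _)))
                            (∘-monoʳ _ (QCat.unit A x))))
          (act φ x x y y′)

  actʳ : {A B : QCat Q} (φ : A ⇸ B) → ∀ {p p′ q}
         (x′ : QCat.Ob A p′) (x : QCat.Ob A p) (y : QCat.Ob B q) →
         arr φ x y ∘ QCat.hom A x′ x ≤ arr φ x′ y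
  actʳ {A} {B} φ x′ x y =
    trans (reflexive (Eq.sym (identityˡ _)))
      (trans (∘-monoˡ _ (QCat.unit B y)) (act φ x′ x y y))

  private
    mkDist : {A B : QCat Q} →
             (φ : ∀ {p q} → QCat.Ob A p → QCat.Ob B q → Hom p q) →
             (∀ {p q q′} (x : QCat.Ob A p) (y : QCat.Ob B q) (y′ : QCat.Ob B q′) →
               QCat.hom B y y′ ∘ φ x y ≤ φ x y′) →
             (∀ {p p′ q} (x′ : QCat.Ob A p′) (x : QCat.Ob A p) (y : QCat.Ob B q) →
               φ x y ∘ QCat.hom A x′ x ≤ φ x′ y) →
             A ⇸ B
    mkDist φ l r = record
      { arr = φ
      ; act = λ x′ x y y′ → trans (∘-monoʳ _ (r x′ x y)) (l x′ y y′)
      }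

  infixr 9 _∘ᴰ_
  _∘ᴰ_ : {A B C : QCat Q} → B ⇸ C → A ⇸ B → A ⇸ C
  _∘ᴰ_ {A} {B} {C} ψ φ = mkDist
    (λ x z → ⋁ (term x z))
    (λ x z z′ → trans (reflexive (∘-⋁ʳ _ (term x z))) (⋁-least _ λ i@(_ , y) →
      trans (reflexive (Eq.sym (assoc _ _ _)))
        (trans (∘-monoˡ _ (actˡ ψ y z z′)) (⋁-upper (term x z′) i))))
    (λ x′ x z → trans (reflexive (∘-⋁ˡ (term x z) _)) (⋁-least _ λ i@(_ , y) →
      trans (reflexive (assoc _ _ _))
        (trans (∘-monoʳ _ (actʳ φ x′ x y)) (⋁-upper (term x′ z) i))))
    where
    term : ∀ {p r} → QCat.Ob A p → QCat.Ob C r → QCat.Total B → Hom p r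
    term x z (_ , y) = arr ψ y z ∘ arr φ x y

  infixl 8 _↙ᴰ_
  _↙ᴰ_ : {A B C : QCat Q} → A ⇸ C → A ⇸ B → B ⇸ C
  _↙ᴰ_ {A} {B} {C} ξ φ = mkDist
    (λ y z → ⋀ (term y z))
    (λ y z z′ → ⋀-greatest (term y z′) λ i@(_ , x) → ↙-intro
      (trans (reflexive (assoc _ _ _))
        (trans (∘-monoʳ _ (↙-elim (⋀-lower (term y z) i))) (actˡ ξ x z z′))))
    (λ y′ y z → ⋀-greatest (term y′ z) λ i@(_ , x) → ↙-intro
      (trans (reflexive (assoc _ _ _))
        (trans (∘-monoʳ _ (actˡ φ x y′ y)) (↙-elim (⋀-lower (term y z) i)))))
    where
    term : ∀ {q r} → QCat.Ob B q → QCat.Ob C r → QCat.Total A → Hom q r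
    term y z (_ , x) = arr ξ x z ↙ arr φ x y

  infixr 8 _↘ᴰ_
  _↘ᴰ_ : {A B C : QCat Q} → B ⇸ C → A ⇸ C → A ⇸ B
  _↘ᴰ_ {A} {B} {C} ψ ξ = mkDist
    (λ x y → ⋀ (term x y))
    (λ x y y′ → ⋀-greatest (term x y′) λ i@(_ , z) → ↘-intro
      (trans (reflexive (Eq.sym (assoc _ _ _)))
        (trans (∘-monoˡ _ (actʳ ψ y y′ z)) (↘-elim (⋀-lower (term x y) i)))))
    (λ x′ x y → ⋀-greatest (term x′ y) λ i@(_ , z) → ↘-intro
      (trans (reflexive (Eq.sym (assoc _ _ _)))
        (trans (∘-monoˡ _ (↘-elim (⋀-lower (term x y) i))) (actʳ ξ x′ x z))))
    where
    term : ∀ {p q} → QCat.Ob A p → QCat.Ob B q → QCat.Total C → Hom p q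
    term x y (_ , z) = arr ψ y z ↘ arr ξ x z

  infix 10 _♮ₗ _♮ᵘ

  -- F ♮ₗ is F with lower ♮, and F ♮ᵘ is F with upper ♮.
  _♮ₗ : {A B : QCat Q} → QFunctor A B → A ⇸ B
  _♮ₗ {A} {B} F = mkDist
    (λ x y → QCat.hom B (map F x) y)
    (λ x y y′ → QCat.comp B (map F x) y y′)
    (λ x′ x y → trans (∘-monoʳ _ (mono F x′ x)) (QCat.comp B (map F x′) (map F x) y))

  _♮ᵘ : {A B : QCat Q} → QFunctor A B → B ⇸ A
  _♮ᵘ {A} {B} F = mkDist
    (λ y x → QCat.hom B y (map F x))
    (λ y x x′ → trans (∘-monoˡ _ (mono F x x′)) (QCat.comp B y (map F x) (map F x′)))
    (λ y′ y x → QCat.comp B y′ y (map F x))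

  data Point (q : Obj) : Obj → Set ℓ where
    ⋆ : Point q q

  ⟦_⟧ : Obj → QCat Q
  ⟦ q ⟧ = record
    { Ob   = Point q
    ; hom  = λ { ⋆ ⋆ → id }
    ; unit = λ { ⋆ → refl }
    ; comp = λ { ⋆ ⋆ ⋆ → reflexive (identityˡ id) }
    }

  Presheaf Copresheaf : QCat Q → Obj → Set ℓ
  Presheaf   A q = A ⇸ ⟦ q ⟧
  Copresheaf A q = ⟦ q ⟧ ⇸ A

  module _ {A B : QCat Q} where

    IsColimit : ∀ {q} → Presheaf A q → QFunctor A B → QCat.Ob B q → Set ℓ
    IsColimit μ F c =
      ∀ {r} (y : QCat.Ob B r) → QCat.hom B c y ≈ arr (F ♮ₗ ↙ᴰ μ) ⋆ y

    IsLimit : ∀ {q} → Copresheaf A q → QFunctor A B → QCat.Ob B q → Set ℓ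
    IsLimit lam F l =
      ∀ {r} (y : QCat.Ob B r) → QCat.hom B y l ≈ arr (lam ↘ᴰ F ♮ᵘ) y ⋆

    Dense : QFunctor A B → Set ℓ
    Dense F = ∀ {q} (y : QCat.Ob B q) →
      Σ[ μ ∈ Presheaf A q ] Σ[ c ∈ QCat.Ob B q ]
        (IsColimit μ F c × QCat._≅_ B y c)

    Codense : QFunctor A B → Set ℓ
    Codense F = ∀ {q} (y : QCat.Ob B q) →
      Σ[ lam ∈ Copresheaf A q ] Σ[ l ∈ QCat.Ob B q ]
        (IsLimit lam F l × QCat._≅_ B y l)

  Complete : QCat Q → Set (suc ℓ)
  Complete B = (A : QCat Q) (F : QFunctor A B) {q : Obj} (μ : Presheaf A q) →
    Σ[ c ∈ QCat.Ob B q ] IsColimit μ F c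

{-# OPTIONS --safe #-}
module Submission where

-- By the co-Yoneda identities the condition on distributors says exactly that
-- D(SKa, Hb) ≈ X(Fa, Gb) for all a and b (compose-♮ₗ, compose-♮ᵘ).
--
-- If X is equivalent to Fix(TS), take K and H to be identities, let G : D → X
-- be T (whose values are fixed points of TS) followed by Fix(TS) → X, and let
-- F be G ∘ S.  All four functors are essentially surjective, hence dense and
-- codense, and X(GSc, Gd) ≈ C(TSc, Td) ≈ D(Sc, d) by the adjunction.
--
-- Conversely, density of F means that the homs of X can be computed from the
-- nerves X(F-, x) of its objects (dense-intro); likewise for K and C.  It
-- therefore suffices to pair the objects of X with those of Fix(TS) so that
-- paired objects have the same nerve (SameNerve, nerve-equivalence).  Both
-- directions of the pairing come from one fact (colimits-sameNerve): for every
-- presheaf μ on A,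
--
--   X(Fa, colim_μ F) ≈ C(Ka, TS(colim_μ K)).
--
-- Indeed X(colim_μ F, Gb) and D(S(colim_μ K), Hb) are both the infimum over a
-- of X(Fa, Gb) ↙ μ(a), because S preserves colimits; since G and H are codense,
-- it follows that X(Fa, colim_μ F) ≈ D(SKa, S(colim_μ K)), which is the claim
-- by adjunction.  For c in Fix(TS) the weight μ = C(K-, c) has colim_μ K ≅ c
-- by density of K, so colim_μ F is the partner of c; for x in X the weight
-- μ = X(F-, x) has colim_μ F ≅ x, so TS(colim_μ K) is the partner of x.

open import Defs
open import Level using (Level)
open import Data.Product using (Σ-syntax; _×_; _,_; proj₁; proj₂)
open import Function.Bundles using (_⇔_; mk⇔)
import Relation.Binary.Reasoning.PartialOrder as PosetReasoning

module _ {ℓ : Level} {Q : Quantaloid ℓ} where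
  open Quantaloid Q hiding (hom)

  private
    module ≤-Reasoning {p q : Obj} =
      PosetReasoning (CompleteLattice.poset (Quantaloid.hom Q p q))
  open ≤-Reasoning

  -- Homs of 𝒬-categories

  module _ (A : QCat Q) where
    open QCat A

    ⊑-precompose : ∀ {p q} {x x′ : Ob p} (y : Ob q) →
                   x ⊑ x′ → hom x′ y ≤ hom x y
    ⊑-precompose {x = x} {x′} y x⊑x′ = begin
      hom x′ y             ≈⟨ identityʳ _ ⟨
      hom x′ y ∘ id        ≤⟨ ∘-monoʳ _ x⊑x′ ⟩
      hom x′ y ∘ hom x x′  ≤⟨ comp x x′ y ⟩
      hom x y              ∎

    ⊑-postcompose : ∀ {p q} (x : Ob p) {y y′ : Ob q} →
                    y ⊑ y′ → hom x y ≤ hom x y′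
    ⊑-postcompose x {y} {y′} y⊑y′ = begin
      hom x y              ≈⟨ identityˡ _ ⟨
      id ∘ hom x y         ≤⟨ ∘-monoˡ _ y⊑y′ ⟩
      hom y y′ ∘ hom x y   ≤⟨ comp x y y′ ⟩
      hom x y′             ∎

    ⊑-trans : ∀ {q} {x y z : Ob q} → x ⊑ y → y ⊑ z → x ⊑ z
    ⊑-trans {x = x} x⊑y y⊑z = trans x⊑y (⊑-postcompose x y⊑z)

  map-⊑ : {A B : QCat Q} (F : QFunctor A B) → ∀ {q} {x y : QCat.Ob A q} →
          QCat._⊑_ A x y → QCat._⊑_ B (map F x) (map F y)
  map-⊑ F x⊑y = trans x⊑y (mono F _ _)

  -- Composition with the distributors of a functor

  compose-♮ₗ : {A B E : QCat Q} (φ : B ⇸ E) (F : QFunctor A B) →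
               ∀ {p q} (a : QCat.Ob A p) (z : QCat.Ob E q) →
               arr (φ ∘ᴰ F ♮ₗ) a z ≈ arr φ (map F a) z
  compose-♮ₗ {B = B} φ F a z = antisym
    (⋁-least _ λ (_ , y) → actʳ φ (map F a) y z)
    (begin
      arr φ (map F a) z                                     ≈⟨ identityʳ _ ⟨
      arr φ (map F a) z ∘ id                                ≤⟨ ∘-monoʳ _ (QCat.unit B (map F a)) ⟩
      arr φ (map F a) z ∘ QCat.hom B (map F a) (map F a)    ≤⟨ ⋁-upper _ (_ , map F a) ⟩
      arr (φ ∘ᴰ F ♮ₗ) a z                                   ∎)

  compose-♮ᵘ : {A B E : QCat Q} (H : QFunctor B E) (φ : A ⇸ E) →
               ∀ {p q} (a : QCat.Ob A p) (b : QCat.Ob B q) →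
               arr (H ♮ᵘ ∘ᴰ φ) a b ≈ arr φ a (map H b)
  compose-♮ᵘ {E = E} H φ a b = antisym
    (⋁-least _ λ (_ , y) → actˡ φ a y (map H b))
    (begin
      arr φ a (map H b)                                     ≈⟨ identityˡ _ ⟨
      id ∘ arr φ a (map H b)                                ≤⟨ ∘-monoˡ _ (QCat.unit E (map H b)) ⟩
      QCat.hom E (map H b) (map H b) ∘ arr φ a (map H b)    ≤⟨ ⋁-upper _ (_ , map H b) ⟩
      arr (H ♮ᵘ ∘ᴰ φ) a b                                   ∎)

  -- Weighted colimits and limits

  module _ {A B : QCat Q} (F : QFunctor A B) where
    private
      module A = QCat A
      module B = QCat B

    -- The presheaf B(F-, y) on A.
    nerve : ∀ {q} → B.Ob q → Presheaf A q
    nerve y = record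
      { arr = λ { a ⋆ → B.hom (map F a) y }
      ; act = λ { a′ a ⋆ ⋆ → begin
          id ∘ B.hom (map F a) y ∘ A.hom a′ a               ≈⟨ identityˡ _ ⟩
          B.hom (map F a) y ∘ A.hom a′ a                    ≤⟨ ∘-monoʳ _ (mono F a′ a) ⟩
          B.hom (map F a) y ∘ B.hom (map F a′) (map F a)    ≤⟨ B.comp _ _ _ ⟩
          B.hom (map F a′) y                                ∎ }
      }

    -- The copresheaf B(y, F-) on A.
    conerve : ∀ {q} → B.Ob q → Copresheaf A q
    conerve y = record
      { arr = λ { ⋆ a → B.hom y (map F a) }
      ; act = λ { ⋆ ⋆ a a′ → begin
          A.hom a a′ ∘ B.hom y (map F a) ∘ id               ≈⟨ ∘-cong Eq.refl (identityʳ _) ⟩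
          A.hom a a′ ∘ B.hom y (map F a)                    ≤⟨ ∘-monoˡ _ (mono F a a′) ⟩
          B.hom (map F a) (map F a′) ∘ B.hom y (map F a)    ≤⟨ B.comp _ _ _ ⟩
          B.hom y (map F a′)                                ∎ }
      }

    module _ {q} (μ : Presheaf A q) {c : B.Ob q} (colim : IsColimit μ F c) where

      colimit-intro : ∀ {r} {y : B.Ob r} {w : Hom q r} →
        (∀ {p} (a : A.Ob p) → w ∘ arr μ a ⋆ ≤ B.hom (map F a) y) → w ≤ B.hom c y
      colimit-intro {y = y} w∘μ≤ = trans
        (⋀-greatest _ λ (_ , a) → ↙-intro (w∘μ≤ a))
        (reflexive (Eq.sym (colim y)))

      colimit-elim : ∀ {r} {y : B.Ob r} {w : Hom q r} → w ≤ B.hom c y →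
        ∀ {p} (a : A.Ob p) → w ∘ arr μ a ⋆ ≤ B.hom (map F a) y
      colimit-elim {y = y} w≤ a = ↙-elim
        (trans w≤ (trans (reflexive (colim y)) (⋀-lower _ (_ , a))))

      colimit-cocone : ∀ {p} (a : A.Ob p) → arr μ a ⋆ ≤ B.hom (map F a) c
      colimit-cocone a = begin
        arr μ a ⋆            ≈⟨ identityˡ _ ⟨
        id ∘ arr μ a ⋆       ≤⟨ colimit-elim (B.unit c) a ⟩
        B.hom (map F a) c    ∎

    module _ {q} (lam : Copresheaf A q) {l : B.Ob q} (lim : IsLimit lam F l) where

      limit-intro : ∀ {r} {y : B.Ob r} {w : Hom r q} →
        (∀ {p} (a : A.Ob p) → arr lam ⋆ a ∘ w ≤ B.hom y (map F a)) → w ≤ B.hom y l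
      limit-intro {y = y} lam∘w≤ = trans
        (⋀-greatest _ λ (_ , a) → ↘-intro (lam∘w≤ a))
        (reflexive (Eq.sym (lim y)))

      limit-elim : ∀ {r} {y : B.Ob r} {w : Hom r q} → w ≤ B.hom y l →
        ∀ {p} (a : A.Ob p) → arr lam ⋆ a ∘ w ≤ B.hom y (map F a)
      limit-elim {y = y} w≤ a = ↘-elim
        (trans w≤ (trans (reflexive (lim y)) (⋀-lower _ (_ , a))))

      limit-cone : ∀ {p} (a : A.Ob p) → arr lam ⋆ a ≤ B.hom l (map F a)
      limit-cone a = begin
        arr lam ⋆ a          ≈⟨ identityʳ _ ⟨
        arr lam ⋆ a ∘ id     ≤⟨ limit-elim (B.unit l) a ⟩
        B.hom l (map F a)    ∎

  -- Density and codensity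

    -- Since x is a colimit of F, a hom out of x can be tested against the homs
    -- F a → x.
    dense-intro : Dense F → ∀ {q r} {x : B.Ob q} {y : B.Ob r} {w : Hom q r} →
      (∀ {p} (a : A.Ob p) → w ∘ B.hom (map F a) x ≤ B.hom (map F a) y) →
      w ≤ B.hom x y
    dense-intro dense {x = x} {y} {w} w∘nerve≤ with dense x
    ... | μ , c , colim , x⊑c , c⊑x = trans
      (colimit-intro μ colim λ a → begin
        w ∘ arr μ a ⋆            ≤⟨ ∘-monoʳ w (colimit-cocone μ colim a) ⟩
        w ∘ B.hom (map F a) c    ≤⟨ ∘-monoʳ w (⊑-postcompose B _ c⊑x) ⟩
        w ∘ B.hom (map F a) x    ≤⟨ w∘nerve≤ a ⟩
        B.hom (map F a) y        ∎)
      (⊑-precompose B y x⊑c)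

    codense-intro : Codense F → ∀ {q r} {x : B.Ob q} {y : B.Ob r} {w : Hom q r} →
      (∀ {p} (a : A.Ob p) → B.hom y (map F a) ∘ w ≤ B.hom x (map F a)) →
      w ≤ B.hom x y
    codense-intro codense {x = x} {y} {w} conerve∘w≤ with codense y
    ... | lam , l , lim , y⊑l , l⊑y = trans
      (limit-intro lam lim λ a → begin
        arr lam ⋆ a ∘ w          ≤⟨ ∘-monoˡ w (limit-cone lam lim a) ⟩
        B.hom l (map F a) ∘ w    ≤⟨ ∘-monoˡ w (⊑-precompose B _ y⊑l) ⟩
        B.hom y (map F a) ∘ w    ≤⟨ conerve∘w≤ a ⟩
        B.hom x (map F a)        ∎)
      (⊑-postcompose B x l⊑y)

    dense⇒colimit-nerve : Dense F → ∀ {q} (x : B.Ob q) → IsColimit (nerve x) F x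
    dense⇒colimit-nerve dense x y = antisym
      (⋀-greatest _ λ (_ , a) → ↙-intro (B.comp (map F a) x y))
      (dense-intro dense λ a → ↙-elim (⋀-lower _ (_ , a)))

    -- Every object of B is isomorphic to some F a.
    EssentiallySurjective : Set ℓ
    EssentiallySurjective =
      ∀ {q} (y : B.Ob q) → Σ[ a ∈ A.Ob q ] (y B.≅ map F a)

  private variable
    A B : QCat Q

  -- The weight is the representable presheaf A(-, a), whose colimit is F a by
  -- the Yoneda lemma.
  essentiallySurjective⇒dense : (F : QFunctor A B) →
                                EssentiallySurjective F → Dense F
  essentiallySurjective⇒dense {A} {B} F surj y with surj y
  ... | a , y≅Fa = nerve idᶠ a , map F a , yoneda , y≅Fa
    where
    module A = QCat A
    module B = QCat B
    yoneda : IsColimit (nerve idᶠ a) F (map F a)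
    yoneda z = antisym
      (⋀-greatest _ λ (_ , a′) → ↙-intro
        (trans (∘-monoʳ _ (mono F a′ a)) (B.comp _ _ _)))
      (begin
        arr (F ♮ₗ ↙ᴰ nerve idᶠ a) ⋆ z                 ≈⟨ identityʳ _ ⟨
        arr (F ♮ₗ ↙ᴰ nerve idᶠ a) ⋆ z ∘ id            ≤⟨ ∘-monoʳ _ (A.unit a) ⟩
        arr (F ♮ₗ ↙ᴰ nerve idᶠ a) ⋆ z ∘ A.hom a a     ≤⟨ ↙-elim (⋀-lower _ (_ , a)) ⟩
        B.hom (map F a) z                             ∎)

  essentiallySurjective⇒codense : (F : QFunctor A B) →
                                  EssentiallySurjective F → Codense F
  essentiallySurjective⇒codense {A} {B} F surj y with surj y
  ... | a , y≅Fa = conerve idᶠ a , map F a , yoneda , y≅Fa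
    where
    module A = QCat A
    module B = QCat B
    yoneda : IsLimit (conerve idᶠ a) F (map F a)
    yoneda z = antisym
      (⋀-greatest _ λ (_ , a′) → ↘-intro
        (trans (∘-monoˡ _ (mono F a a′)) (B.comp _ _ _)))
      (begin
        arr (conerve idᶠ a ↘ᴰ F ♮ᵘ) z ⋆               ≈⟨ identityˡ _ ⟨
        id ∘ arr (conerve idᶠ a ↘ᴰ F ♮ᵘ) z ⋆          ≤⟨ ∘-monoˡ _ (A.unit a) ⟩
        A.hom a a ∘ arr (conerve idᶠ a ↘ᴰ F ♮ᵘ) z ⋆   ≤⟨ ↘-elim (⋀-lower _ (_ , a)) ⟩
        B.hom z (map F a)                             ∎)

  idᶠ-essentiallySurjective : EssentiallySurjective (idᶠ {A = A})
  idᶠ-essentiallySurjective {A} y = y , QCat.unit A y , QCat.unit A y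

  -- Objects with the same nerve

  -- B(Fa, y) and E(Ka, z) agree for every a.
  SameNerve : {A B E : QCat Q} (F : QFunctor A B) (K : QFunctor A E) →
              ∀ {q} → QCat.Ob B q → QCat.Ob E q → Set ℓ
  SameNerve {A} {B} {E} F K y z =
    ∀ {p} (a : QCat.Ob A p) → QCat.hom B (map F a) y ≈ QCat.hom E (map K a) z

  sameNerve-sym : {A B E : QCat Q} (F : QFunctor A B) (K : QFunctor A E) →
    ∀ {q} {y : QCat.Ob B q} {z : QCat.Ob E q} →
    SameNerve F K y z → SameNerve K F z y
  sameNerve-sym F K same a = Eq.sym (same a)

  sameNerve⇒hom-≤ : {A B E : QCat Q} (F : QFunctor A B) (K : QFunctor A E) →
    Dense K →
    ∀ {q r} {y : QCat.Ob B q} {y′ : QCat.Ob B r} {z : QCat.Ob E q} {z′ : QCat.Ob E r} →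
    SameNerve F K y z → SameNerve F K y′ z′ →
    QCat.hom B y y′ ≤ QCat.hom E z z′
  sameNerve⇒hom-≤ {B = B} {E} F K dense {y = y} {y′} {z} {z′} same same′ =
    dense-intro K dense λ a → begin
      B.hom y y′ ∘ E.hom (map K a) z    ≈⟨ ∘-cong Eq.refl (same a) ⟨
      B.hom y y′ ∘ B.hom (map F a) y    ≤⟨ B.comp _ _ _ ⟩
      B.hom (map F a) y′                ≈⟨ same′ a ⟩
      E.hom (map K a) z′                ∎
    where
    module B = QCat B
    module E = QCat E

  -- Y need not contain the image of K, so the statement compares X with a full
  -- subcategory of E rather than with E itself.
  nerve-equivalence : {A X E : QCat Q} (Y : ∀ {q} → QCat.Ob E q → Set ℓ)
    (F : QFunctor A X) (K : QFunctor A E) → Dense F → Dense K →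
    (∀ {q} (x : QCat.Ob X q) → Σ[ y ∈ QCat.Ob (subcategory E Y) q ] SameNerve F K x (proj₁ y)) →
    (∀ {q} (y : QCat.Ob (subcategory E Y) q) → Σ[ x ∈ QCat.Ob X q ] SameNerve F K x (proj₁ y)) →
    Equivalent X (subcategory E Y)
  nerve-equivalence {X = X} {E} Y F K denseF denseK toY toX =
    record
      { map  = λ x → proj₁ (toY x)
      ; mono = λ x x′ → X≤E (proj₂ (toY x)) (proj₂ (toY x′))
      } ,
    record
      { map  = λ y → proj₁ (toX y)
      ; mono = λ y y′ → E≤X (proj₂ (toX y)) (proj₂ (toX y′))
      } ,
    ( (λ x → trans (E.unit _) (E≤X (proj₂ (toX _)) (proj₂ (toY x))))
    , (λ x → trans (E.unit _) (E≤X (proj₂ (toY x)) (proj₂ (toX _)))) ) ,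
    ( (λ y → trans (X.unit _) (X≤E (proj₂ (toY _)) (proj₂ (toX y))))
    , (λ y → trans (X.unit _) (X≤E (proj₂ (toX y)) (proj₂ (toY _)))) )
    where
    module X = QCat X
    module E = QCat E
    X≤E : ∀ {q r} {x : X.Ob q} {x′ : X.Ob r} {e : E.Ob q} {e′ : E.Ob r} →
          SameNerve F K x e → SameNerve F K x′ e′ → X.hom x x′ ≤ E.hom e e′
    X≤E = sameNerve⇒hom-≤ F K denseK
    E≤X : ∀ {q r} {x : X.Ob q} {x′ : X.Ob r} {e : E.Ob q} {e′ : E.Ob r} →
          SameNerve F K x e → SameNerve F K x′ e′ → E.hom e e′ ≤ X.hom x x′
    E≤X same same′ = sameNerve⇒hom-≤ K F denseF
      (sameNerve-sym F K same) (sameNerve-sym F K same′)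

  -- Adjunctions and their fixed points

  module _ {C D : QCat Q} (S : QFunctor C D) (T : QFunctor D C) (S⊣T : S ⊣ T) where
    private
      module C = QCat C
      module D = QCat D

    unit-η : ∀ {q} (c : C.Ob q) → c C.⊑ map T (map S c)
    unit-η = proj₁ S⊣T

    counit-ε : ∀ {q} (d : D.Ob q) → map S (map T d) D.⊑ d
    counit-ε = proj₂ S⊣T

    transpose : ∀ {p q} (c : C.Ob p) (d : D.Ob q) →
                D.hom (map S c) d ≈ C.hom c (map T d)
    transpose c d = antisym
      (trans (mono T _ _) (⊑-precompose C _ (unit-η c)))
      (trans (mono S _ _) (⊑-postcompose D _ (counit-ε d)))

    -- T with codomain restricted to the fixed points of TS.
    T-fixed : QFunctor D (Fix (T ∘ᶠ S))
    T-fixed = record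
      { map  = λ d → map T d , map-⊑ T (counit-ε d) , unit-η (map T d)
      ; mono = mono T
      }

    -- S preserves the colimit k of K, and homs from SKa to d agree with homs
    -- from Fa to y, so the homs out of the colimits Sk and x agree as well.
    colimit-homs : {X A : QCat Q} (F : QFunctor A X) (K : QFunctor A C)
      {q r : Obj} (μ : Presheaf A q) {x : QCat.Ob X q} {k : C.Ob q} →
      IsColimit μ F x → IsColimit μ K k →
      (y : QCat.Ob X r) (d : D.Ob r) →
      (∀ {p} (a : QCat.Ob A p) →
        D.hom (map S (map K a)) d ≈ QCat.hom X (map F a) y) →
      D.hom (map S k) d ≈ QCat.hom X x y
    colimit-homs {X} F K μ {x} {k} colimF colimK y d same = antisym
      (colimit-intro F μ colimF λ a → begin
        D.hom (map S k) d ∘ arr μ a ⋆    ≤⟨ colimit-elim K μ colimK (reflexive (transpose k d)) a ⟩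
        C.hom (map K a) (map T d)        ≈⟨ transpose _ d ⟨
        D.hom (map S (map K a)) d        ≈⟨ same a ⟩
        X.hom (map F a) y                ∎)
      (trans
        (colimit-intro K μ colimK λ a → begin
          X.hom x y ∘ arr μ a ⋆          ≤⟨ colimit-elim F μ colimF refl a ⟩
          X.hom (map F a) y              ≈⟨ same a ⟨
          D.hom (map S (map K a)) d      ≈⟨ transpose _ d ⟩
          C.hom (map K a) (map T d)      ∎)
        (reflexive (Eq.sym (transpose k d))))
      where module X = QCat X

    module _ {X A B : QCat Q}
             (F : QFunctor A X) (K : QFunctor A C)
             (G : QFunctor B X) (H : QFunctor B D)
             (codenseG : Codense G) (codenseH : Codense H)
             (same : ∀ {p q} (a : QCat.Ob A p) (b : QCat.Ob B q) →
               D.hom (map S (map K a)) (map H b) ≈ QCat.hom X (map F a) (map G b))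
             where
      private
        module X = QCat X

      colimits-sameNerve : ∀ {q} (μ : Presheaf A q) {x : X.Ob q} {k : C.Ob q} →
        IsColimit μ F x → IsColimit μ K k →
        SameNerve F K x (map T (map S k))
      colimits-sameNerve μ {x} {k} colimF colimK a = Eq.trans
        (antisym
          (codense-intro H codenseH λ b → begin
            D.hom (map S k) (map H b) ∘ X.hom (map F a) x    ≈⟨ ∘-cong (conerves b) Eq.refl ⟩
            X.hom x (map G b) ∘ X.hom (map F a) x            ≤⟨ X.comp _ _ _ ⟩
            X.hom (map F a) (map G b)                        ≈⟨ same a b ⟨
            D.hom (map S (map K a)) (map H b)                ∎)
          (codense-intro G codenseG λ b → begin
            X.hom x (map G b) ∘ D.hom (map S (map K a)) (map S k)
              ≈⟨ ∘-cong (conerves b) Eq.refl ⟨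
            D.hom (map S k) (map H b) ∘ D.hom (map S (map K a)) (map S k)
              ≤⟨ D.comp _ _ _ ⟩
            D.hom (map S (map K a)) (map H b)
              ≈⟨ same a b ⟩
            X.hom (map F a) (map G b) ∎))
        (transpose (map K a) (map S k))
        where
        conerves : ∀ {r} (b : QCat.Ob B r) →
                   D.hom (map S k) (map H b) ≈ X.hom x (map G b)
        conerves b = colimit-homs F K μ colimF colimK (map G b) (map H b)
                     λ a′ → same a′ b

      -- The partner of x is TS applied to the colimit of K weighted by X(F-, x);
      -- the partner of c is the colimit of F weighted by C(K-, c).
      equivalent-Fix : Complete C → Complete X → Dense F → Dense K →
                       Equivalent X (Fix (T ∘ᶠ S))
      equivalent-Fix completeC completeX denseF denseK =
        nerve-equivalence _ F K denseF denseK toFix fromFix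
        where
        toFix : ∀ {q} (x : X.Ob q) →
                Σ[ c ∈ QCat.Ob (Fix (T ∘ᶠ S)) q ] SameNerve F K x (proj₁ c)
        toFix x with completeC A K (nerve F x)
        ... | k , colimK = map T-fixed (map S k) ,
          colimits-sameNerve (nerve F x) (dense⇒colimit-nerve F denseF x) colimK

        fromFix : ∀ {q} (c : QCat.Ob (Fix (T ∘ᶠ S)) q) →
                  Σ[ x ∈ X.Ob q ] SameNerve F K x (proj₁ c)
        fromFix (c , TSc⊑c , c⊑TSc) with completeX A F (nerve K c)
        ... | x , colimF = x , λ a → Eq.trans
          (colimits-sameNerve (nerve K c) colimF (dense⇒colimit-nerve K denseK c) a)
          (antisym (⊑-postcompose C _ TSc⊑c) (⊑-postcompose C _ c⊑TSc))

    module _ {X : QCat Q} (E : QFunctor X (Fix (T ∘ᶠ S))) (E⁻ : QFunctor (Fix (T ∘ᶠ S)) X)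
             (E⁻E≅id : E⁻ ∘ᶠ E ≅ᶠ idᶠ) (EE⁻≅id : E ∘ᶠ E⁻ ≅ᶠ idᶠ) where
      private
        module X = QCat X
        Fix-TS : QCat Q
        Fix-TS = Fix (T ∘ᶠ S)
        module Fix = QCat Fix-TS

      -- T followed by the equivalence Fix(TS) → X.
      fixedRight : QFunctor D X
      fixedRight = E⁻ ∘ᶠ T-fixed

      fixedLeft : QFunctor C X
      fixedLeft = fixedRight ∘ᶠ S

      -- If E x is the fixed point c, then TSc ≅ c gives x ≅ E⁻ (E x) ≅ fixedLeft c.
      fixedLeft-essentiallySurjective : EssentiallySurjective fixedLeft
      fixedLeft-essentiallySurjective x with map E x | proj₁ E⁻E≅id x | proj₂ E⁻E≅id x
      ... | u@(c , TSc⊑c , c⊑TSc) | E⁻Ex⊑x | x⊑E⁻Ex = c ,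
        ⊑-trans X x⊑E⁻Ex (map-⊑ E⁻ {x = u} {map T-fixed (map S c)} c⊑TSc) ,
        ⊑-trans X (map-⊑ E⁻ {x = map T-fixed (map S c)} {u} TSc⊑c) E⁻Ex⊑x

      fixedRight-essentiallySurjective : EssentiallySurjective fixedRight
      fixedRight-essentiallySurjective x with fixedLeft-essentiallySurjective x
      ... | c , x≅ = map S c , x≅

      -- The equivalence preserves homs, and precomposition with the unit turns
      -- C(TSc, Td) into C(c, Td).
      hom-fixed : ∀ {p q} (c : C.Ob p) (d : D.Ob q) →
                  D.hom (map S c) d ≈ X.hom (map fixedLeft c) (map fixedRight d)
      hom-fixed c d = antisym (mono fixedRight (map S c) d) (begin
        X.hom (map E⁻ u) (map E⁻ v)                      ≤⟨ mono E _ _ ⟩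
        Fix.hom (map E (map E⁻ u)) (map E (map E⁻ v))
          ≤⟨ ⊑-precompose Fix-TS {x = u} {map E (map E⁻ u)} (map E (map E⁻ v)) (proj₂ EE⁻≅id u) ⟩
        Fix.hom u (map E (map E⁻ v))
          ≤⟨ ⊑-postcompose Fix-TS u {map E (map E⁻ v)} {v} (proj₁ EE⁻≅id v) ⟩
        C.hom (map T (map S c)) (map T d)                ≤⟨ ⊑-precompose C _ (unit-η c) ⟩
        C.hom c (map T d)                                ≈⟨ transpose c d ⟨
        D.hom (map S c) d                                ∎)
        where
        u = map T-fixed (map S c)
        v = map T-fixed d

theorem5p1 : {ℓ : Level} (Q : Quantaloid ℓ) (C D : QCat Q) → Complete C → Complete D →
    (S : QFunctor C D) (T : QFunctor D C) → S ⊣ T →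
    (X : QCat Q) → Complete X →
    Equivalent X (Fix (T ∘ᶠ S)) ⇔
    (Σ[ A ∈ QCat Q ] Σ[ B ∈ QCat Q ]
    Σ[ F ∈ QFunctor A X ] Σ[ K ∈ QFunctor A C ]
    Σ[ G ∈ QFunctor B X ] Σ[ H ∈ QFunctor B D ]
    (Dense F × Dense K × Codense G × Codense H ×
    H ♮ᵘ ∘ᴰ S ♮ₗ ∘ᴰ K ♮ₗ ≈ᴰ G ♮ᵘ ∘ᴰ F ♮ₗ))
theorem5p1 Q C D completeC _ S T S⊣T X completeX = mk⇔
  (λ (E , E⁻ , E⁻E≅id , EE⁻≅id) →
    let F = fixedLeft S T S⊣T E E⁻ E⁻E≅id EE⁻≅id
        G = fixedRight S T S⊣T E E⁻ E⁻E≅id EE⁻≅id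
    in C , D , F , idᶠ , G , idᶠ ,
       essentiallySurjective⇒dense F
         (fixedLeft-essentiallySurjective S T S⊣T E E⁻ E⁻E≅id EE⁻≅id) ,
       essentiallySurjective⇒dense idᶠ (idᶠ-essentiallySurjective {A = C}) ,
       essentiallySurjective⇒codense G
         (fixedRight-essentiallySurjective S T S⊣T E E⁻ E⁻E≅id EE⁻≅id) ,
       essentiallySurjective⇒codense idᶠ (idᶠ-essentiallySurjective {A = D}) ,
       λ c d → Eq.trans (composite-hom idᶠ idᶠ c d)
         (Eq.trans (hom-fixed S T S⊣T E E⁻ E⁻E≅id EE⁻≅id c d)
           (Eq.sym (compose-♮ₗ (G ♮ᵘ) F c d))))
  (λ (A , B , F , K , G , H , denseF , denseK , codenseG , codenseH , eq) →
    equivalent-Fix S T S⊣T F K G H codenseG codenseH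
      (λ a b → Eq.trans (Eq.sym (composite-hom K H a b))
        (Eq.trans (eq a b) (compose-♮ₗ (G ♮ᵘ) F a b)))
      completeC completeX denseF denseK)
  where
  open Quantaloid Q using (_≈_; module Eq)
  composite-hom :
        ∀ {A B : QCat Q} (K : QFunctor A C) (H : QFunctor B D) {p q}
        (a : QCat.Ob A p) (b : QCat.Ob B q) →
        arr (H ♮ᵘ ∘ᴰ S ♮ₗ ∘ᴰ K ♮ₗ) a b ≈ QCat.hom D (map S (map K a)) (map H b)
  composite-hom K H a b = Eq.trans
    (compose-♮ᵘ H (S ♮ₗ ∘ᴰ K ♮ₗ) a b)
    (compose-♮ₗ (S ♮ₗ) K a (map H b))
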